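{- If $G$ is a graph with maximum degree $\Delta(G)\ge 3$, then $\alpha_{\mathrm{od}}(G)\ge |G|/((\Delta(G))^2-1)$.
   Context: All graphs are finite and simple; $|G|$ is the number of vertices. An odd independent set in $G=(V,E)$ is an independent set $S\subseteq V$ such that for every $v\in V\setminus S$, either $N(v)\cap S=\varnothing$ or $|N(v)\cap S|$ is odd, where $N(v)$ is the open neighborhood of $v$. $\alpha_{\mathrm{od}}(G)$ is the maximum size of an odd independent set of $G$. -}

module Defs where

open import Data.Fin.Base using (Fin)
open import Data.Fin.Properties using (all?)
open import Data.Fin.Subset using (Subset; inside; outside; _∈_; _∉_; _∩_; ∣_∣; Empty)
open import Data.Fin.Subset.Properties using (_∈?_; nonempty?)
open import Data.List.Base using (List; []; _∷_; _++_; map; filter; allFin)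
open import Data.List.Extrema.Nat using (max)
open import Data.Nat.Base using (ℕ; zero; suc; _∸_; _^_; _≤_; _<_; _%_; NonZero; >-nonZero; z≤n; s≤s)
open import Data.Nat.Properties using (_≟_; ^-monoˡ-≤; m<n⇒0<n∸m; ≤-trans)
open import Data.Product.Base using (_×_)
open import Data.Sum.Base using (_⊎_)
import Data.Vec.Base as Vec
open import Level using (0ℓ)
open import Relation.Binary.Core using (Rel)
import Relation.Binary.Definitions as Binary
open import Relation.Binary.PropositionalEquality.Core using (_≡_)
open import Relation.Nullary.Decidable.Core using (does; ¬?; _×-dec_; _⊎-dec_; _→-dec_)
open import Relation.Nullary.Negation.Core using (¬_)
import Relation.Unary as Unary

record Graph : Set₁ where
  field
    order      : ℕ
    Adj        : Rel (Fin order) 0ℓ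
    Adj?       : Binary.Decidable Adj
    Adj-sym    : Binary.Symmetric Adj
    Adj-irrefl : ∀ v → ¬ Adj v v

  Vertex : Set
  Vertex = Fin order

  N : Vertex → Subset order
  N v = Vec.tabulate λ w → does (Adj? v w)

  degree : Vertex → ℕ
  degree v = ∣ N v ∣

  Δ : ℕ
  Δ = max 0 (map degree (allFin order))

  Independent : Subset order → Set
  Independent S = ∀ u v → u ∈ S → v ∈ S → ¬ Adj u v

  OddIndependent : Subset order → Set
  OddIndependent S =
    Independent S ×
    (∀ v → v ∉ S → Empty (N v ∩ S) ⊎ ∣ N v ∩ S ∣ % 2 ≡ 1)

  independent? : Unary.Decidable Independent
  independent? S =
    all? λ u → all? λ v → (u ∈? S) →-dec ((v ∈? S) →-dec ¬? (Adj? u v))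

  oddIndependent? : Unary.Decidable OddIndependent
  oddIndependent? S =
    independent? S ×-dec
    all? λ v → ¬? (v ∈? S) →-dec
      (¬? (nonempty? (N v ∩ S)) ⊎-dec (∣ N v ∩ S ∣ % 2 ≟ 1))

subsets : ∀ n → List (Subset n)
subsets zero    = Vec.[] ∷ []
subsets (suc n) =
  map (inside Vec.∷_) (subsets n) ++ map (outside Vec.∷_) (subsets n)

-- The base value 0 does not affect the maximum: the empty set is odd independent.
αod : Graph → ℕ
αod G = max 0 (map ∣_∣ (filter oddIndependent? (subsets order)))
  where open Graph G

m²∸1-nonZero : ∀ {m} → 3 ≤ m → NonZero (m ^ 2 ∸ 1)
m²∸1-nonZero 3≤m =
  >-nonZero (m<n⇒0<n∸m (≤-trans 1<9 (^-monoˡ-≤ 2 3≤m)))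
  where
  1<9 : 1 < 9
  1<9 = s≤s (s≤s z≤n)

{-# OPTIONS --safe #-}
module Submission where

-- Grow an odd independent set S greedily, keeping the set of vertices within
-- distance two of S (its ball) of size at most (Δ² − 1)∣S∣.  A ball around a
-- vertex has at most Δ² + 1 elements.  A new vertex outside the ball of S but
-- adjacent to it costs at most Δ² − 1, since its ball already shares two
-- vertices with that of S.  So only the first choice in each component is an
-- issue, when all balls there have at least Δ² elements.  Counting paths of
-- length at most two then shows that the component is Δ-regular and
-- triangle-free and that every vertex is on at most one 4-cycle.  Three
-- neighbours of a vertex u, chosen with no other common neighbour, form an odd
-- independent set whose balls overlap enough.  They exist unless Δ = 3 and u is
-- on a 4-cycle; if this holds everywhere, two vertices at distance three cost at
-- most 2(Δ² − 1), and they exist because a cubic graph cannot have nine vertices.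

open import Defs
open import Data.Nat.Base using (_∸_; _^_; _≤_)
open import Data.Rational.Base using (_≥_; _/_)

import Data.Integer.Base as ℤ
import Data.Integer.Properties as ℤ
import Data.Rational.Properties as ℚ
import Data.Rational.Unnormalised.Base as ℚᵘ
import Data.Rational.Unnormalised.Properties as ℚᵘ
open import Data.Bool.Base using (if_then_else_)
open import Data.Empty using (⊥-elim)
open import Data.Fin.Base using (Fin; zero; suc)
open import Data.Fin.Properties using (_≟_; any?)
open import Data.Fin.Subset
open import Data.Fin.Subset.Properties
open import Data.List.Base using (List; []; _∷_; length; map)
open import Data.List.Extrema.Nat using (xs≤max)
open import Data.List.Membership.Propositional using () renaming (_∈_ to _∈ₗ_)
open import Data.List.Membership.Propositional.Properties using (∈-map⁺; ∈-++⁺ˡ; ∈-++⁺ʳ; ∈-filter⁺; ∈-allFin)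
open import Data.List.Relation.Unary.All as All using (All; []; _∷_)
open import Data.List.Relation.Unary.AllPairs using ([]; _∷_)
open import Data.List.Relation.Unary.Any using (here)
open import Data.List.Relation.Unary.Unique.Propositional using (Unique)
open import Data.Nat.Base hiding (_^_; _/_; _≥_; _∸_; _≤_)
open import Data.Nat.Divisibility using (_∣?_; divides) renaming (_∣_ to _∣ℕ_)
import Data.Nat.ListAction as List using (sum)
open import Data.Nat.Properties hiding (_≟_)
open import Data.Nat.Tactic.RingSolver using (solve-∀)
open import Data.Product.Base using (_×_; _,_; ∃; proj₁; proj₂)
open import Data.Sum.Base using (_⊎_; inj₁; inj₂)
import Data.Vec.Base as Vec
import Data.Vec.Functional as Vector
import Data.Vec.Functional.Properties as Vector
import Data.Vec.Properties as Vec
open import Function.Base using (_∘_; const; case_of_)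
open import Relation.Binary.PropositionalEquality
open import Relation.Nullary.Decidable using (Dec; yes; no; does; ¬?; _×-dec_; _⊎-dec_; dec-true; dec-false; from-no; decidable-stable)
open import Relation.Nullary.Negation using (¬_; contradiction)
import Relation.Unary as Unary

open import Algebra.Properties.Semiring.Sum +-*-semiring
  using (sum; sum-cong-≗; ∑-distrib-+; ∑-comm; *-distribˡ-sum; *-distribʳ-sum)

private
  variable
    n : ℕ
    P Q : Set

-- Sums and indicators

sum-mono-≤ : {f g : Fin n → ℕ} → (∀ i → f i ≤ g i) → sum f ≤ sum g
sum-mono-≤ {zero}  f≤g = z≤n
sum-mono-≤ {suc n} f≤g = +-mono-≤ (f≤g zero) (sum-mono-≤ (f≤g ∘ suc))

sum-updateAt-0 : (f : Fin n → ℕ) (i : Fin n) →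
                 sum f ≡ f i + sum (Vector.updateAt f i (const 0))
sum-updateAt-0 f zero    = refl
sum-updateAt-0 f (suc i) = begin
  f zero + sum (f ∘ suc)          ≡⟨ cong (λ k → f zero + k) (sum-updateAt-0 (f ∘ suc) i) ⟩
  f zero + (f (suc i) + rest)     ≡⟨ +-assoc (f zero) _ _ ⟨
  f zero + f (suc i) + rest       ≡⟨ cong (_+ rest) (+-comm (f zero) _) ⟩
  f (suc i) + f zero + rest       ≡⟨ +-assoc (f (suc i)) _ _ ⟩
  f (suc i) + (f zero + rest)     ∎
  where
  open ≡-Reasoning
  rest = sum (Vector.updateAt (f ∘ suc) i (const 0))

-- Entry `i` is set to 0 once it has been counted; as the list has no repetitions, its remaining
-- terms do not see the change, and the vector keeps its length.
unique-sum≤ : (f : Fin n → ℕ) {is : List (Fin n)} → Unique is → List.sum (map f is) ≤ sum f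
unique-sum≤ f {[]}     _           = z≤n
unique-sum≤ f {i ∷ is} (i∉is ∷ is!) = begin
  f i + List.sum (map f is)   ≡⟨ cong (λ k → f i + k) (agree i∉is) ⟩
  f i + List.sum (map f′ is)  ≤⟨ +-monoʳ-≤ (f i) (unique-sum≤ f′ is!) ⟩
  f i + sum f′                ≡⟨ sum-updateAt-0 f i ⟨
  sum f                       ∎
  where
  open ≤-Reasoning
  f′ = Vector.updateAt f i (const 0)
  agree : ∀ {js} → All (i ≢_) js → List.sum (map f js) ≡ List.sum (map f′ js)
  agree []          = refl
  agree (i≢j ∷ i∉js) =
    cong₂ _+_ (sym (Vector.updateAt-minimal _ i f (i≢j ∘ sym))) (agree i∉js)

term≤sum : (f : Fin n → ℕ) (i : Fin n) → f i ≤ sum f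
term≤sum f i = subst (_≤ sum f) (+-identityʳ (f i)) (unique-sum≤ f ([] ∷ []))

-- Induction on the size: the first row and the first column meet in a zero and have equal sums by
-- symmetry, so removing both changes the total by an even number.
symmetric-sum-even : (f : Fin n → Fin n → ℕ) → (∀ i j → f i j ≡ f j i) → (∀ i → f i i ≡ 0) →
                     2 ∣ℕ sum (λ i → sum (f i))
symmetric-sum-even {zero}  f f-sym f-irrefl = divides 0 refl
symmetric-sum-even {suc n} f f-sym f-irrefl
  with divides k eq ← symmetric-sum-even (λ i j → f (suc i) (suc j)) (λ _ _ → f-sym _ _) (λ _ → f-irrefl _)
  = divides (row + k) (begin
  f zero zero + row + sum (λ i → f (suc i) zero + sum (λ j → f (suc i) (suc j)))
    ≡⟨ cong₂ (λ a b → a + row + b) (f-irrefl zero) (∑-distrib-+ (λ i → f (suc i) zero) _) ⟩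
  row + (sum (λ i → f (suc i) zero) + sum (λ i → sum (λ j → f (suc i) (suc j))))
    ≡⟨ cong₂ (λ a b → row + (a + b)) (sum-cong-≗ (λ i → f-sym (suc i) zero)) eq ⟩
  row + (row + k * 2)
    ≡⟨ identity row k ⟩
  (row + k) * 2 ∎)
  where
  open ≡-Reasoning
  row = sum (λ j → f zero (suc j))
  identity : ∀ r k → r + (r + k * 2) ≡ (r + k) * 2
  identity = solve-∀

𝟙 : Dec P → ℕ
𝟙 P? = if does P? then 1 else 0

𝟙-true : (P? : Dec P) → P → 𝟙 P? ≡ 1
𝟙-true P? p = cong (if_then 1 else 0) (dec-true P? p)

𝟙-false : (P? : Dec P) → ¬ P → 𝟙 P? ≡ 0
𝟙-false P? ¬p = cong (if_then 1 else 0) (dec-false P? ¬p)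

𝟙≤ : (P? : Dec P) {m : ℕ} → (P → 1 ≤ m) → 𝟙 P? ≤ m
𝟙≤ (yes p) 1≤m = 1≤m p
𝟙≤ (no _)  1≤m = z≤n

𝟙-cong : (P? : Dec P) (Q? : Dec Q) → (P → Q) → (Q → P) → 𝟙 P? ≡ 𝟙 Q?
𝟙-cong (yes p) Q? f g = sym (𝟙-true Q? (f p))
𝟙-cong (no ¬p) Q? f g = sym (𝟙-false Q? (¬p ∘ g))

-- Finite subsets

χ : Subset n → Fin n → ℕ
χ p x = 𝟙 (x ∈? p)

∣p∣≡sum-χ : (p : Subset n) → ∣ p ∣ ≡ sum (χ p)
∣p∣≡sum-χ Vec.[]              = refl
∣p∣≡sum-χ (inside  Vec.∷ p) = cong suc (∣p∣≡sum-χ p)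
∣p∣≡sum-χ (outside Vec.∷ p) = ∣p∣≡sum-χ p

module _ {P : Fin n → Set} (P? : Unary.Decidable P) where

  -- Unfolds to the same expression as `N v` when `P?` is `Adj? v`, so the two membership lemmas
  -- below also serve for neighbourhoods.
  ⟦_⟧ : Subset n
  ⟦_⟧ = Vec.tabulate (does ∘ P?)

  ∈⟦⟧⁺ : ∀ {x} → P x → x ∈ ⟦_⟧
  ∈⟦⟧⁺ {x} px = Vec.lookup⇒[]= x _ (trans (Vec.lookup∘tabulate _ x) (dec-true (P? x) px))

  ∈⟦⟧⁻ : ∀ {x} → x ∈ ⟦_⟧ → P x
  ∈⟦⟧⁻ {x} x∈ = decidable-stable (P? x) λ ¬px →
    case trans (sym (dec-false (P? x) ¬px)) (trans (sym (Vec.lookup∘tabulate _ x)) (Vec.[]=⇒lookup x∈)) of λ ()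

∣p∪q∣≤∣p∣+∣q∣ : (p q : Subset n) → ∣ p ∪ q ∣ ≤ ∣ p ∣ + ∣ q ∣
∣p∪q∣≤∣p∣+∣q∣ Vec.[] Vec.[] = z≤n
∣p∪q∣≤∣p∣+∣q∣ (outside Vec.∷ p) (outside Vec.∷ q) = ∣p∪q∣≤∣p∣+∣q∣ p q
∣p∪q∣≤∣p∣+∣q∣ (outside Vec.∷ p) (inside  Vec.∷ q) =
  subst (suc ∣ p ∪ q ∣ ≤_) (sym (+-suc ∣ p ∣ ∣ q ∣)) (s≤s (∣p∪q∣≤∣p∣+∣q∣ p q))
∣p∪q∣≤∣p∣+∣q∣ (inside  Vec.∷ p) (y Vec.∷ q) =
  s≤s (≤-trans (∣p∪q∣≤∣p∣+∣q∣ p q) (+-monoʳ-≤ ∣ p ∣ (∣p∣≤∣x∷p∣ y q)))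

disjoint⇒∣p∣+∣q∣≤∣p∪q∣ : (p q : Subset n) → (∀ {x} → x ∈ p → x ∉ q) → ∣ p ∣ + ∣ q ∣ ≤ ∣ p ∪ q ∣
disjoint⇒∣p∣+∣q∣≤∣p∪q∣ p q disjoint = begin
  ∣ p ∣ + ∣ q ∣              ≡⟨ cong₂ _+_ (∣p∣≡sum-χ p) (∣p∣≡sum-χ q) ⟩
  sum (χ p) + sum (χ q)      ≡⟨ ∑-distrib-+ (χ p) (χ q) ⟨
  sum (λ x → χ p x + χ q x)  ≤⟨ sum-mono-≤ pointwise ⟩
  sum (χ (p ∪ q))            ≡⟨ ∣p∣≡sum-χ (p ∪ q) ⟨
  ∣ p ∪ q ∣                  ∎
  where
  open ≤-Reasoning
  pointwise : ∀ x → χ p x + χ q x ≤ χ (p ∪ q) x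
  pointwise x with x ∈? p
  ... | yes x∈p = ≤-reflexive (trans (cong suc (𝟙-false (x ∈? q) (disjoint x∈p)))
                                     (sym (𝟙-true (x ∈? p ∪ q) (p⊆p∪q q x∈p))))
  ... | no  _   = 𝟙≤ (x ∈? q) (λ x∈q → ≤-reflexive (sym (𝟙-true (x ∈? p ∪ q) (q⊆p∪q p q x∈q))))

subset-of-size : (p : Subset n) (k : ℕ) → k ≤ ∣ p ∣ → ∃ λ q → q ⊆ p × ∣ q ∣ ≡ k
subset-of-size Vec.[] zero _ = Vec.[] , (λ x → x) , refl
subset-of-size (outside Vec.∷ p) k k≤ with q , q⊆p , ∣q∣≡k ← subset-of-size p k k≤ =
  outside Vec.∷ q , out⊆ q⊆p , ∣q∣≡k
subset-of-size {n} (inside Vec.∷ p) zero _ = ⊥ , ⊥⊆ , ∣⊥∣≡0 n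
subset-of-size (inside Vec.∷ p) (suc k) (s≤s k≤) with q , q⊆p , ∣q∣≡k ← subset-of-size p k k≤ =
  inside Vec.∷ q , in⊆in q⊆p , cong suc ∣q∣≡k

subset-avoiding : (p : Subset n) (x : Fin n) (k : ℕ) → suc k ≤ ∣ p ∣ → ∃ λ q → q ⊆ p × x ∉ q × ∣ q ∣ ≡ k
subset-avoiding p x k k<∣p∣ =
  let q , q⊆ , ∣q∣≡k = subset-of-size (p ∩ ∁ ⁅ x ⁆) k (≤-pred (begin
        suc k                             ≤⟨ k<∣p∣ ⟩
        ∣ p ∣                             ≤⟨ p⊆q⇒∣p∣≤∣q∣ split ⟩
        ∣ ⁅ x ⁆ ∪ (p ∩ ∁ ⁅ x ⁆) ∣         ≤⟨ ∣p∪q∣≤∣p∣+∣q∣ ⁅ x ⁆ _ ⟩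
        ∣ ⁅ x ⁆ ∣ + ∣ p ∩ ∁ ⁅ x ⁆ ∣       ≡⟨ cong (_+ ∣ p ∩ ∁ ⁅ x ⁆ ∣) (∣⁅x⁆∣≡1 x) ⟩
        suc ∣ p ∩ ∁ ⁅ x ⁆ ∣               ∎)) in
  q , p∩q⊆p p _ ∘ q⊆ , (λ x∈q → x∈∁p⇒x∉p (p∩q⊆q p _ (q⊆ x∈q)) (x∈⁅x⁆ x)) , ∣q∣≡k
  where
  open ≤-Reasoning
  split : p ⊆ ⁅ x ⁆ ∪ (p ∩ ∁ ⁅ x ⁆)
  split {y} y∈p with y ∈? ⁅ x ⁆
  ... | yes y∈x = p⊆p∪q _ y∈x
  ... | no  y∉x = q⊆p∪q ⁅ x ⁆ _ (x∈p∩q⁺ (y∈p , x∉p⇒x∈∁p y∉x))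

∈-subsets : (p : Subset n) → p ∈ₗ subsets n
∈-subsets Vec.[]              = here refl
∈-subsets (inside  Vec.∷ p) = ∈-++⁺ˡ (∈-map⁺ (inside Vec.∷_) (∈-subsets p))
∈-subsets (outside Vec.∷ p) = ∈-++⁺ʳ _ (∈-map⁺ (outside Vec.∷_) (∈-subsets p))

-- `Δ` and `αod` as upper bounds

module _ (G : Graph) where
  open Graph G

  degree≤Δ : ∀ v → degree v ≤ Δ
  degree≤Δ v = All.lookup (xs≤max 0 _) (∈-map⁺ degree (∈-allFin v))

  oddIndependent⇒∣S∣≤αod : ∀ {S} → OddIndependent S → ∣ S ∣ ≤ αod G
  oddIndependent⇒∣S∣≤αod {S} odd =
    All.lookup (xs≤max 0 _) (∈-map⁺ ∣_∣ (∈-filter⁺ oddIndependent? (∈-subsets S) odd))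

-- Balls of radius two

module Balls (G : Graph) where
  open Graph G

  ∈N⁺ : ∀ {v w} → Adj v w → w ∈ N v
  ∈N⁺ {v} = ∈⟦⟧⁺ (Adj? v)

  ∈N⁻ : ∀ {v w} → w ∈ N v → Adj v w
  ∈N⁻ {v} = ∈⟦⟧⁻ (Adj? v)

  ∈N∩⁺ : ∀ {v w S} → Adj v w → w ∈ S → w ∈ N v ∩ S
  ∈N∩⁺ vw w∈S = x∈p∩q⁺ (∈N⁺ vw , w∈S)

  ∈N∩⁻ : ∀ {v w S} → w ∈ N v ∩ S → Adj v w × w ∈ S
  ∈N∩⁻ {v} {w} {S} w∈ with w∈N , w∈S ← x∈p∩q⁻ (N v) S w∈ = ∈N⁻ w∈N , w∈S

  Adj⇒≢ : ∀ {v w} → Adj v w → v ≢ w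
  Adj⇒≢ vw refl = Adj-irrefl _ vw

  Near : Vertex → Vertex → Set
  Near s x = s ≡ x ⊎ Adj s x ⊎ ∃ λ w → Adj s w × Adj w x

  near? : ∀ s → Unary.Decidable (Near s)
  near? s x = (s ≟ x) ⊎-dec (Adj? s x ⊎-dec any? λ w → Adj? s w ×-dec Adj? w x)

  Covers : Subset order → Vertex → Set
  Covers S x = ∃ λ s → s ∈ S × Near s x

  covers? : ∀ S → Unary.Decidable (Covers S)
  covers? S x = any? λ s → (s ∈? S) ×-dec near? s x

  ball : Subset order → Subset order
  ball S = ⟦ covers? S ⟧

  ∈ball⁺ : ∀ {S s x} → s ∈ S → Near s x → x ∈ ball S
  ∈ball⁺ {S} s∈S sx = ∈⟦⟧⁺ (covers? S) (_ , s∈S , sx)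

  ∈ball⁻ : ∀ {S x} → x ∈ ball S → Covers S x
  ∈ball⁻ {S} = ∈⟦⟧⁻ (covers? S)

  ∈ball-⁅⁆⁻ : ∀ {s x} → x ∈ ball ⁅ s ⁆ → Near s x
  ∈ball-⁅⁆⁻ {s} x∈ with s′ , s′∈ , s′x ← ∈ball⁻ x∈ with refl ← x∈⁅y⁆⇒x≡y s s′∈ = s′x

  ball-∪ : ∀ S T → ∣ ball (S ∪ T) ∣ ≤ ∣ ball S ∣ + ∣ ball T ∩ ∁ (ball S) ∣
  ball-∪ S T = ≤-trans (p⊆q⇒∣p∣≤∣q∣ split) (∣p∪q∣≤∣p∣+∣q∣ (ball S) _)
    where
    split : ball (S ∪ T) ⊆ ball S ∪ (ball T ∩ ∁ (ball S))
    split {x} x∈ with x ∈? ball S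
    ... | yes x∈S = p⊆p∪q _ x∈S
    ... | no  x∉S with s , s∈ , sx ← ∈ball⁻ x∈ with x∈p∪q⁻ S T s∈
    ... | inj₁ s∈S = contradiction (∈ball⁺ s∈S sx) x∉S
    ... | inj₂ s∈T = q⊆p∪q (ball S) _ (x∈p∩q⁺ (∈ball⁺ s∈T sx , x∉p⇒x∈∁p x∉S))

  -- No vertex sees both S and T, so every vertex outside S ∪ T sees only one of them.
  ∪-oddIndependent : ∀ {S T} → OddIndependent S → OddIndependent T → (∀ {t} → t ∈ T → t ∉ ball S) →
                     OddIndependent (S ∪ T)
  ∪-oddIndependent {S} {T} (S-indep , S-odd) (T-indep , T-odd) far = indep , odd
    where
    apart : ∀ {s t} → s ∈ S → t ∈ T → ¬ Near s t
    apart s∈S t∈T st = far t∈T (∈ball⁺ s∈S st)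

    indep : Independent (S ∪ T)
    indep u v u∈ v∈ uv with x∈p∪q⁻ S T u∈ | x∈p∪q⁻ S T v∈
    ... | inj₁ u∈S | inj₁ v∈S = S-indep u v u∈S v∈S uv
    ... | inj₁ u∈S | inj₂ v∈T = apart u∈S v∈T (inj₂ (inj₁ uv))
    ... | inj₂ u∈T | inj₁ v∈S = apart v∈S u∈T (inj₂ (inj₁ (Adj-sym uv)))
    ... | inj₂ u∈T | inj₂ v∈T = T-indep u v u∈T v∈T uv

    seesOnly : ∀ {v p q} → (∀ {x} → x ∈ p → x ∈ q) → (∀ {x} → Adj v x → x ∈ q → x ∈ p) →
               N v ∩ p ≡ N v ∩ q
    seesOnly p⊆q q⊆p = ⊆-antisym
      (λ x∈ → let vx , x∈p = ∈N∩⁻ x∈ in ∈N∩⁺ vx (p⊆q x∈p))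
      (λ x∈ → let vx , x∈q = ∈N∩⁻ x∈ in ∈N∩⁺ vx (q⊆p vx x∈q))

    odd : ∀ v → v ∉ S ∪ T → Empty (N v ∩ (S ∪ T)) ⊎ ∣ N v ∩ (S ∪ T) ∣ % 2 ≡ 1
    odd v v∉ with nonempty? (N v ∩ S)
    ... | yes (s , s∈) =
      subst (λ p → Empty p ⊎ ∣ p ∣ % 2 ≡ 1) (seesOnly (p⊆p∪q T) onlyS) (S-odd v (v∉ ∘ p⊆p∪q T))
      where
      onlyS : ∀ {x} → Adj v x → x ∈ S ∪ T → x ∈ S
      onlyS vx x∈ with x∈p∪q⁻ S T x∈
      ... | inj₁ x∈S = x∈S
      ... | inj₂ x∈T with vs , s∈S ← ∈N∩⁻ s∈ =
        ⊥-elim (apart s∈S x∈T (inj₂ (inj₂ (v , Adj-sym vs , vx))))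
    ... | no none =
      subst (λ p → Empty p ⊎ ∣ p ∣ % 2 ≡ 1) (seesOnly (q⊆p∪q S T) onlyT) (T-odd v (v∉ ∘ q⊆p∪q S T))
      where
      onlyT : ∀ {x} → Adj v x → x ∈ S ∪ T → x ∈ T
      onlyT vx x∈ with x∈p∪q⁻ S T x∈
      ... | inj₁ x∈S = contradiction (_ , ∈N∩⁺ vx x∈S) none
      ... | inj₂ x∈T = x∈T

  atMostOne⇒odd : ∀ {v T} → (∀ {s t} → s ∈ T → t ∈ T → Adj v s → Adj v t → s ≡ t) →
                  Empty (N v ∩ T) ⊎ ∣ N v ∩ T ∣ % 2 ≡ 1
  atMostOne⇒odd {v} {T} unique with nonempty? (N v ∩ T)
  ... | no none      = inj₁ none
  ... | yes (s , s∈) = inj₂ (cong (_% 2) (trans (cong ∣_∣ (⊆-antisym ⊆⁅s⁆ ⁅s⁆⊆)) (∣⁅x⁆∣≡1 s)))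
    where
    ⊆⁅s⁆ : N v ∩ T ⊆ ⁅ s ⁆
    ⊆⁅s⁆ t∈ with vs , s∈T ← ∈N∩⁻ s∈ with vt , t∈T ← ∈N∩⁻ t∈ =
      subst (_∈ ⁅ s ⁆) (unique s∈T t∈T vs vt) (x∈⁅x⁆ s)
    ⁅s⁆⊆ : ⁅ s ⁆ ⊆ N v ∩ T
    ⁅s⁆⊆ x∈ = subst (_∈ N v ∩ T) (sym (x∈⁅y⁆⇒x≡y s x∈)) s∈

  ⁅⁆-oddIndependent : ∀ v → OddIndependent ⁅ v ⁆
  ⁅⁆-oddIndependent v =
    (λ s t s∈ t∈ st → Adj⇒≢ st (same s∈ t∈)) , λ w _ → atMostOne⇒odd (λ s∈ t∈ _ _ → same s∈ t∈)
    where
    same : ∀ {s t} → s ∈ ⁅ v ⁆ → t ∈ ⁅ v ⁆ → s ≡ t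
    same s∈ t∈ = trans (x∈⁅y⁆⇒x≡y v s∈) (sym (x∈⁅y⁆⇒x≡y v t∈))

  ⊥-oddIndependent : OddIndependent ⊥
  ⊥-oddIndependent = (λ u v u∈ → ⊥-elim (∉⊥ u∈)) , λ v _ → inj₁ λ (x , x∈) → ∉⊥ (proj₂ (∈N∩⁻ {v} x∈))

  -- Counting paths of length at most two

  A : Vertex → Vertex → ℕ
  A v w = 𝟙 (Adj? v w)

  A-sym : ∀ v w → A v w ≡ A w v
  A-sym v w = 𝟙-cong (Adj? v w) (Adj? w v) Adj-sym Adj-sym

  A-irrefl : ∀ v → A v v ≡ 0
  A-irrefl v = 𝟙-false (Adj? v v) (Adj-irrefl v)

  degree≡sum-A : ∀ v → degree v ≡ sum (A v)
  degree≡sum-A v = trans (∣p∣≡sum-χ (N v)) (sum-cong-≗ λ w → 𝟙-cong (w ∈? N v) (Adj? v w) ∈N⁻ ∈N⁺)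

  codegree : Vertex → Vertex → ℕ
  codegree s x = sum λ w → A s w * A w x

  codegree-self : ∀ s → codegree s s ≡ degree s
  codegree-self s = trans (sum-cong-≗ pointwise) (sym (degree≡sum-A s))
    where
    pointwise : ∀ w → A s w * A w s ≡ A s w
    pointwise w rewrite A-sym w s with Adj? s w
    ... | yes _ = refl
    ... | no  _ = refl

  length≤codegree : ∀ {s x ws} → Unique ws → All (λ w → Adj s w × Adj w x) ws →
                    length ws ≤ codegree s x
  length≤codegree {s} {x} ws! paths =
    ≤-trans (≤-reflexive (count paths)) (unique-sum≤ (λ w → A s w * A w x) ws!)
    where
    count : ∀ {ws} → All (λ w → Adj s w × Adj w x) ws →
            length ws ≡ List.sum (map (λ w → A s w * A w x) ws)
    count []                          = refl
    count {w ∷ _} ((sw , wx) ∷ paths) =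
      cong₂ _+_ (sym (cong₂ _*_ (𝟙-true (Adj? s w) sw) (𝟙-true (Adj? w x) wx))) (count paths)

  -- The number of paths of length at most two from s to x.
  mult : Vertex → Vertex → ℕ
  mult s x = if does (s ≟ x) then 1 else A s x + codegree s x

  mult-≢ : ∀ {s x} → s ≢ x → mult s x ≡ A s x + codegree s x
  mult-≢ {s} {x} s≢x = cong (if_then 1 else A s x + codegree s x) (dec-false (s ≟ x) s≢x)

  length≤mult : ∀ {s x ws} → s ≢ x → Unique ws → All (λ w → Adj s w × Adj w x) ws → length ws ≤ mult s x
  length≤mult s≢x ws! paths = ≤-trans (length≤codegree ws! paths)
    (≤-trans (m≤n+m _ _) (≤-reflexive (sym (mult-≢ s≢x))))

  1≤mult : ∀ {s x} → Near s x → 1 ≤ mult s x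
  1≤mult {s} {x} sx with s ≟ x
  1≤mult {s} {x} _                            | yes _  = ≤-refl
  1≤mult {s} {x} (inj₁ s≡x)                   | no s≢x = contradiction s≡x s≢x
  1≤mult {s} {x} (inj₂ (inj₁ sx))             | no _   =
    ≤-trans (≤-reflexive (sym (𝟙-true (Adj? s x) sx))) (m≤m+n _ _)
  1≤mult {s} {x} (inj₂ (inj₂ (w , sw , wx)))  | no _   =
    ≤-trans (length≤codegree ([] ∷ []) ((sw , wx) ∷ [])) (m≤n+m _ _)

  triangle⇒2≤mult : ∀ {s x w} → Adj s x → Adj s w → Adj w x → 2 ≤ mult s x
  triangle⇒2≤mult {s} {x} sx sw wx = begin
    1 + 1                   ≤⟨ +-mono-≤ (≤-reflexive (sym (𝟙-true (Adj? s x) sx)))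
                                        (length≤codegree ([] ∷ []) ((sw , wx) ∷ [])) ⟩
    A s x + codegree s x    ≡⟨ mult-≢ (Adj⇒≢ sx) ⟨
    mult s x                ∎
    where open ≤-Reasoning

  -- Exchanging the sums groups the walks of length two by their middle vertex: each neighbour `w`
  -- of `s` contributes `degree w`.
  sum-codegree : ∀ {D} s → (∀ v → degree v ≤ D) → sum (codegree s) ≤ degree s * D
  sum-codegree {D} s degree≤D = begin
    sum (λ x → sum (λ w → A s w * A w x))  ≡⟨ ∑-comm (λ x w → A s w * A w x) ⟩
    sum (λ w → sum (λ x → A s w * A w x))  ≡⟨ sum-cong-≗ (λ w → *-distribˡ-sum (A s w) (A w)) ⟨
    sum (λ w → A s w * sum (A w))          ≤⟨ sum-mono-≤ (λ w → *-monoʳ-≤ (A s w)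
                                               (subst (_≤ D) (degree≡sum-A w) (degree≤D w))) ⟩
    sum (λ w → A s w * D)                  ≡⟨ *-distribʳ-sum D (A s) ⟨
    sum (A s) * D                          ≡⟨ cong (_* D) (degree≡sum-A s) ⟨
    degree s * D                           ∎
    where open ≤-Reasoning

  δ : Vertex → Vertex → ℕ
  δ s x = 𝟙 (s ≟ x)

  sum-δ : ∀ s → sum (δ s) ≡ 1
  sum-δ s = trans (sum-cong-≗ λ x → 𝟙-cong (s ≟ x) (x ∈? ⁅ s ⁆)
                     (λ { refl → x∈⁅x⁆ s }) (sym ∘ x∈⁅y⁆⇒x≡y s))
                  (trans (sym (∣p∣≡sum-χ ⁅ s ⁆)) (∣⁅x⁆∣≡1 s))

  -- On the diagonal `mult` counts only the trivial path, whereas `codegree s s` counts the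
  -- `degree s` closed walks. Adding `degree s` on both sides restores these walks, so that the sum
  -- splits into three known ones without subtraction.
  sum-mult : ∀ {D} s → (∀ v → degree v ≤ D) → sum (mult s) ≤ 1 + degree s * D
  sum-mult {D} s degree≤D = +-cancelˡ-≤ d _ _ (begin
    d + sum (mult s)                                  ≡⟨ cong (_+ sum (mult s)) (trans (cong (_* d) (sum-δ s)) (*-identityˡ d)) ⟨
    sum (δ s) * d + sum (mult s)                      ≡⟨ cong (_+ sum (mult s)) (*-distribʳ-sum d (δ s)) ⟩
    sum (λ x → δ s x * d) + sum (mult s)              ≡⟨ ∑-distrib-+ (λ x → δ s x * d) (mult s) ⟨
    sum (λ x → δ s x * d + mult s x)                  ≡⟨ sum-cong-≗ pointwise ⟩
    sum (λ x → δ s x + (A s x + codegree s x))        ≡⟨ ∑-distrib-+ (δ s) _ ⟩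
    sum (δ s) + sum (λ x → A s x + codegree s x)      ≡⟨ cong₂ _+_ (sum-δ s) (∑-distrib-+ (A s) (codegree s)) ⟩
    1 + (sum (A s) + sum (codegree s))                ≤⟨ +-monoʳ-≤ 1 (+-mono-≤ (≤-reflexive (sym (degree≡sum-A s)))
                                                                              (sum-codegree s degree≤D)) ⟩
    1 + (d + d * D)                                   ≡⟨ +-suc d (d * D) ⟨
    d + (1 + d * D)                                   ∎)
    where
    open ≤-Reasoning
    d = degree s
    pointwise : ∀ x → δ s x * d + mult s x ≡ δ s x + (A s x + codegree s x)
    pointwise x with s ≟ x
    ... | no  _    = refl
    ... | yes refl rewrite A-irrefl s | codegree-self s | +-identityʳ d = +-comm d 1

  -- Every element of `q` uses up one path from `s`. The term `mult s x ∸ χ q x` counts the paths to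
  -- `x` that remain: all but one if `x` is in `q`, all of them otherwise.
  ball-excess : ∀ {D s q xs} → (∀ v → degree v ≤ D) → q ⊆ ball ⁅ s ⁆ → Unique xs →
                ∣ q ∣ + List.sum (map (λ x → mult s x ∸ χ q x) xs) ≤ 1 + degree s * D
  ball-excess {D} {s} {q} {xs} degree≤D q⊆ball xs! = begin
    ∣ q ∣ + List.sum (map excess xs)          ≤⟨ +-mono-≤ (≤-reflexive (∣p∣≡sum-χ q)) (unique-sum≤ excess xs!) ⟩
    sum (χ q) + sum excess                    ≡⟨ ∑-distrib-+ (χ q) excess ⟨
    sum (λ x → χ q x + (mult s x ∸ χ q x))    ≡⟨ sum-cong-≗ (λ x → m+[n∸m]≡n
                                                  (𝟙≤ (x ∈? q) (1≤mult ∘ ∈ball-⁅⁆⁻ ∘ q⊆ball))) ⟩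
    sum (mult s)                              ≤⟨ sum-mult s degree≤D ⟩
    1 + degree s * D                          ∎
    where
    open ≤-Reasoning
    excess : Vertex → ℕ
    excess x = mult s x ∸ χ q x

-- The greedy construction

module Greedy (G : Graph) {D K : ℕ} (degree≤D : ∀ v → Graph.degree G v ≤ D)
              (3≤D : 3 ≤ D) (D²≡1+K : D * D ≡ suc K) where
  open Graph G
  open Balls G

  -- Each element of `T` pays for `K` vertices, and only vertices not yet covered by `S` are
  -- charged. Hence the bound on the ball of `S` carries over to `S ∪ T`.
  Extension : Subset order → Set
  Extension S = ∃ λ T → Nonempty T × OddIndependent T × (∀ {t} → t ∈ T → t ∉ ball S) ×
                        ∣ ball T ∩ ∁ (ball S) ∣ ≤ ∣ T ∣ * K

  -- The path count from a vertex exceeds the allowance `K` by at most two, so a single new vertex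
  -- is affordable once two of its paths are wasted.
  1+degree*D≤2+K : ∀ v → 1 + degree v * D ≤ 2 + K
  1+degree*D≤2+K v = s≤s (subst (degree v * D ≤_) D²≡1+K (*-monoˡ-≤ D (degree≤D v)))

  excess≤2+K : ∀ {v q xs} → q ⊆ ball ⁅ v ⁆ → Unique xs →
               ∣ q ∣ + List.sum (map (λ x → mult v x ∸ χ q x) xs) ≤ 2 + K
  excess≤2+K {v} q⊆ball xs! = ≤-trans (ball-excess degree≤D q⊆ball xs!) (1+degree*D≤2+K v)

  k<mult⇒k≤excess : ∀ {v x k} q → k < mult v x → k ≤ mult v x ∸ χ q x
  k<mult⇒k≤excess {v} {x} {k} q k<mult = m+n≤o⇒m≤o∸n k
    (≤-trans (≤-trans (+-monoʳ-≤ k (𝟙≤ (x ∈? q) (λ _ → ≤-refl))) (≤-reflexive (+-comm k 1))) k<mult)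

  -- A vertex already covered is not fresh, so none of the paths that reach it is used up.
  k≤mult⇒k≤excess-old : ∀ {S v x k} → x ∈ ball S → k ≤ mult v x →
                        k ≤ mult v x ∸ χ (ball ⁅ v ⁆ ∩ ∁ (ball S)) x
  k≤mult⇒k≤excess-old {S} {v} {x} {k} x∈ k≤mult =
    subst (λ c → k ≤ mult v x ∸ c) (sym (𝟙-false (x ∈? ball ⁅ v ⁆ ∩ ∁ (ball S)) x∉)) k≤mult
    where
    x∉ : x ∉ ball ⁅ v ⁆ ∩ ∁ (ball S)
    x∉ x∈∩ = x∈∁p⇒x∉p (proj₂ (x∈p∩q⁻ (ball ⁅ v ⁆) _ x∈∩)) x∈

  ⁅⁆-extension : ∀ {S v} → v ∉ ball S → ∣ ball ⁅ v ⁆ ∩ ∁ (ball S) ∣ ≤ K → Extension S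
  ⁅⁆-extension {S} {v} v∉ few =
    ⁅ v ⁆ , (v , x∈⁅x⁆ v) , ⁅⁆-oddIndependent v , (λ t∈ → subst (_∉ ball S) (sym (x∈⁅y⁆⇒x≡y v t∈)) v∉) ,
    ≤-trans few (≤-reflexive (sym (trans (cong (_* K) (∣⁅x⁆∣≡1 v)) (*-identityˡ K))))

  -- If `w` were within distance one of `S`, then `v` would be covered. So `w` is at distance two,
  -- and the middle vertex of a path from `S` to `w` is a second covered vertex near `v`.
  boundary : ∀ {S v w} → v ∉ ball S → w ∈ ball S → Adj v w → ∃ λ y → y ∈ ball S × Adj w y
  boundary {S} {v} {w} v∉ w∈ vw with ∈ball⁻ w∈
  ... | s , s∈S , inj₁ refl =
    contradiction (∈ball⁺ s∈S (inj₂ (inj₁ (Adj-sym vw)))) v∉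
  ... | s , s∈S , inj₂ (inj₁ sw) =
    contradiction (∈ball⁺ s∈S (inj₂ (inj₂ (w , sw , Adj-sym vw)))) v∉
  ... | s , s∈S , inj₂ (inj₂ (y , sy , yw)) = y , ∈ball⁺ s∈S (inj₂ (inj₁ sy)) , Adj-sym yw

  -- The covered vertices `w` and `y` waste one path from `v` each, which is exactly the two that
  -- have to be saved.
  boundary-extension : ∀ {S v w} → v ∉ ball S → w ∈ ball S → Adj v w → Extension S
  boundary-extension {S} {v} {w} v∉ w∈ vw with y , y∈ , wy ← boundary v∉ w∈ vw =
    ⁅⁆-extension v∉ (+-cancelʳ-≤ 2 _ K (begin
      c + 2                                           ≤⟨ +-monoʳ-≤ c (+-mono-≤ (saved w∈ (inj₂ (inj₁ vw)))
                                                          (+-mono-≤ (saved y∈ (inj₂ (inj₂ (w , vw , wy)))) z≤n)) ⟩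
      c + List.sum (map excess (w ∷ y ∷ []))          ≤⟨ excess≤2+K (p∩q⊆p _ _) ((Adj⇒≢ wy ∷ []) ∷ [] ∷ []) ⟩
      2 + K                                           ≡⟨ +-comm 2 K ⟩
      K + 2                                           ∎))
    where
    open ≤-Reasoning
    fresh = ball ⁅ v ⁆ ∩ ∁ (ball S)
    c = ∣ fresh ∣
    excess : Vertex → ℕ
    excess x = mult v x ∸ χ fresh x
    saved : ∀ {x} → x ∈ ball S → Near v x → 1 ≤ excess x
    saved x∈ vx = k≤mult⇒k≤excess-old x∈ (1≤mult vx)

  -- Vertices whose balls have at least `D * D` elements

  Tight : Vertex → Set
  Tight u = K < ∣ ball ⁅ u ⁆ ∣

  -- The ball uses up at least `K + 1` of the at most `K + 2` paths from `u`, which leaves at most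
  -- one redundant path.
  tight-excess : ∀ {u xs} → Tight u → Unique xs →
                 List.sum (map (λ x → mult u x ∸ χ (ball ⁅ u ⁆) x) xs) ≤ 1
  tight-excess tight xs! = +-cancelˡ-≤ (suc K) _ 1
    (≤-trans (+-monoˡ-≤ _ tight) (≤-trans (excess≤2+K ⊆-refl xs!) (≤-reflexive (+-comm 1 (suc K)))))

  tight-pair : ∀ {u x y} → Tight u → x ≢ y → 2 ≤ mult u x → ¬ 2 ≤ mult u y
  tight-pair {u} tight x≢y 2≤x 2≤y = <⇒≱ (n<1+n 1)
    (≤-trans (+-mono-≤ (k<mult⇒k≤excess (ball ⁅ u ⁆) 2≤x) (+-mono-≤ (k<mult⇒k≤excess (ball ⁅ u ⁆) 2≤y) z≤n))
             (tight-excess tight ((x≢y ∷ []) ∷ [] ∷ [])))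

  tight-triple : ∀ {u x} → Tight u → ¬ 3 ≤ mult u x
  tight-triple {u} {x} tight 3≤x = <⇒≱ (n<1+n 1)
    (≤-trans (+-mono-≤ (k<mult⇒k≤excess (ball ⁅ u ⁆) 3≤x) z≤n) (tight-excess {xs = x ∷ []} tight ([] ∷ [])))

  -- A missing edge at `u` lowers the path count by `D`, and then `D * D` elements can be reached
  -- only if `D ≤ 1`.
  tight-degree : ∀ {u} → Tight u → degree u ≡ D
  tight-degree {u} tight with m≤n⇒m<n∨m≡n (degree≤D u)
  ... | inj₂ eq = eq
  ... | inj₁ lt = contradiction D≤1 (<⇒≱ (≤-trans (n<1+n 1) (≤-trans (n≤1+n 2) 3≤D)))
    where
    open ≤-Reasoning
    D≤1 : D ≤ 1
    D≤1 = +-cancelʳ-≤ (degree u * D) D 1 (begin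
      D + degree u * D         ≤⟨ *-monoˡ-≤ D lt ⟩
      D * D                    ≡⟨ D²≡1+K ⟩
      suc K                    ≤⟨ tight ⟩
      ∣ ball ⁅ u ⁆ ∣           ≡⟨ +-identityʳ _ ⟨
      ∣ ball ⁅ u ⁆ ∣ + 0       ≤⟨ ball-excess degree≤D ⊆-refl [] ⟩
      1 + degree u * D         ∎)

  -- In a triangle both `a` and `b` are reached from `u` directly and through each other, which
  -- makes two redundant paths.
  tight-triangleFree : ∀ {u a b} → Tight u → Adj u a → Adj u b → ¬ Adj a b
  tight-triangleFree tight ua ub ab = tight-pair tight (Adj⇒≢ ab)
    (triangle⇒2≤mult ua ub (Adj-sym ab)) (triangle⇒2≤mult ub ua ab)

  -- A 4-cycle `u s x t`, chords allowed, with `x` opposite to `u`.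
  Diamond : Vertex → Set
  Diamond u = ∃ λ x → ∃ λ s → ∃ λ t → u ≢ x × s ≢ t × (Adj u s × Adj s x) × (Adj u t × Adj t x)

  diamond? : Unary.Decidable Diamond
  diamond? u = any? λ x → any? λ s → any? λ t →
    ¬? (u ≟ x) ×-dec ¬? (s ≟ t) ×-dec (Adj? u s ×-dec Adj? s x) ×-dec (Adj? u t ×-dec Adj? t x)

  diamond⇒2≤mult : ∀ {u} → Diamond u → ∃ λ x → 2 ≤ mult u x
  diamond⇒2≤mult (x , s , t , u≢x , s≢t , usx , utx) =
    x , length≤mult u≢x ((s≢t ∷ []) ∷ [] ∷ []) (usx ∷ utx ∷ [])

  -- By `separate`, only the centre `u` has more than one neighbour among the leaves, and it has
  -- three, an odd number. Independence of the leaves is not included; it comes from tightness of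
  -- `u`.
  record Star (u : Vertex) : Set where
    field
      leaves   : Subset order
      ∣leaves∣ : ∣ leaves ∣ ≡ 3
      adjacent : ∀ {t} → t ∈ leaves → Adj u t
      separate : ∀ {v s t} → u ≢ v → s ∈ leaves → t ∈ leaves → Adj v s → Adj v t → s ≡ t

  -- Two neighbours of `u` with another common neighbour lie on a 4-cycle with `u`. If there is no
  -- such cycle, any three neighbours will do. Otherwise tightness allows only one, and leaving out
  -- its vertex `a` breaks it; this requires a fourth neighbour.
  tight⇒star : ∀ {u} → Tight u → Star u ⊎ (D ≡ 3 × Diamond u)
  tight⇒star {u} tight with diamond? u
  ... | no none with T , T⊆N , ∣T∣ ← subset-of-size (N u) 3 (subst (3 ≤_) (sym (tight-degree tight)) 3≤D) =
    inj₁ record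
      { leaves   = T
      ; ∣leaves∣ = ∣T∣
      ; adjacent = ∈N⁻ ∘ T⊆N
      ; separate = λ {v} {s} {t} u≢v s∈ t∈ vs vt → decidable-stable (s ≟ t) λ s≢t →
          none (v , s , t , u≢v , s≢t , (∈N⁻ (T⊆N s∈) , Adj-sym vs) , (∈N⁻ (T⊆N t∈) , Adj-sym vt))
      }
  ... | yes d@(x , a , b , u≢x , a≢b , (ua , ax) , (ub , bx)) with 4 ≤? D
  ...   | no  4≰D = inj₂ (≤-antisym (≤-pred (≰⇒> 4≰D)) 3≤D , d)
  ...   | yes 4≤D
    with T , T⊆N , a∉T , ∣T∣ ← subset-avoiding (N u) a 3 (subst (4 ≤_) (sym (tight-degree tight)) 4≤D) =
    inj₁ record { leaves = T ; ∣leaves∣ = ∣T∣ ; adjacent = adjacent ; separate = separate }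
    where
    adjacent : ∀ {t} → t ∈ T → Adj u t
    adjacent = ∈N⁻ ∘ T⊆N

    a≢leaf : ∀ {t} → t ∈ T → a ≢ t
    a≢leaf t∈ refl = a∉T t∈

    separate : ∀ {v s t} → u ≢ v → s ∈ T → t ∈ T → Adj v s → Adj v t → s ≡ t
    separate {v} {s} {t} u≢v s∈ t∈ vs vt = decidable-stable (s ≟ t) λ s≢t →
      let usv = adjacent s∈ , Adj-sym vs
          utv = adjacent t∈ , Adj-sym vt in
      case v ≟ x of λ where
        -- With `v` opposite to `u` on the known 4-cycle, `a`, `s` and `t` give three paths to the
        -- same vertex.
        (yes refl) → tight-triple tight
          (length≤mult u≢x ((a≢leaf s∈ ∷ a≢leaf t∈ ∷ []) ∷ (s≢t ∷ []) ∷ [] ∷ []) ((ua , ax) ∷ usv ∷ utv ∷ []))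
        -- Otherwise `v` and `x` are two vertices that each have a redundant path.
        (no v≢x) → tight-pair tight v≢x
          (length≤mult u≢v ((s≢t ∷ []) ∷ [] ∷ []) (usv ∷ utv ∷ []))
          (proj₂ (diamond⇒2≤mult d))

  -- The leaves of a star as an odd independent set

  module _ {u} (tight : Tight u) (star : Star u) where
    open Star star renaming (leaves to T)

    star-oddIndependent : OddIndependent T
    star-oddIndependent = (λ s t s∈ t∈ → tight-triangleFree tight (adjacent s∈) (adjacent t∈)) , odd
      where
      odd : ∀ v → v ∉ T → Empty (N v ∩ T) ⊎ ∣ N v ∩ T ∣ % 2 ≡ 1
      odd v _ with u ≟ v
      ... | no  u≢v  = atMostOne⇒odd (separate u≢v)
      ... | yes refl = inj₂ (cong (_% 2) (trans (cong ∣_∣ (⊆-antisym (p∩q⊆q (N u) T) λ t∈ → ∈N∩⁺ (adjacent t∈) t∈)) ∣leaves∣))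

    -- Each of the three leaves lies in the ball of every leaf, so it is counted two times too often.
    star-ball : ∣ ball T ∣ ≤ 3 * K
    star-ball = +-cancelʳ-≤ 6 _ _ (begin
      ∣ ball T ∣ + 6                                       ≡⟨ cong (λ k → ∣ ball T ∣ + 2 * k) ∣leaves∣ ⟨
      ∣ ball T ∣ + 2 * ∣ T ∣                               ≡⟨ cong₂ (λ k l → k + 2 * l) (∣p∣≡sum-χ (ball T)) (∣p∣≡sum-χ T) ⟩
      sum (χ (ball T)) + 2 * sum (χ T)                     ≡⟨ cong (λ k → sum (χ (ball T)) + k) (*-distribˡ-sum 2 (χ T)) ⟩
      sum (χ (ball T)) + sum (λ x → 2 * χ T x)             ≡⟨ ∑-distrib-+ (χ (ball T)) _ ⟨
      sum (λ x → χ (ball T) x + 2 * χ T x)                 ≤⟨ sum-mono-≤ pointwise ⟩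
      sum (λ x → sum (λ t → χ T t * mult t x))             ≡⟨ ∑-comm (λ x t → χ T t * mult t x) ⟩
      sum (λ t → sum (λ x → χ T t * mult t x))             ≡⟨ sum-cong-≗ (λ t → *-distribˡ-sum (χ T t) (mult t)) ⟨
      sum (λ t → χ T t * sum (mult t))                     ≤⟨ sum-mono-≤ (λ t → *-monoʳ-≤ (χ T t) (≤-trans (sum-mult t degree≤D) (1+degree*D≤2+K t))) ⟩
      sum (λ t → χ T t * (2 + K))                          ≡⟨ *-distribʳ-sum (2 + K) (χ T) ⟨
      sum (χ T) * (2 + K)                                  ≡⟨ cong (_* (2 + K)) (trans (sym (∣p∣≡sum-χ T)) ∣leaves∣) ⟩
      3 * (2 + K)                                          ≡⟨ *-distribˡ-+ 3 2 K ⟩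
      6 + 3 * K                                            ≡⟨ +-comm 6 (3 * K) ⟩
      3 * K + 6                                            ∎)
      where
      open ≤-Reasoning
      pointwise : ∀ x → χ (ball T) x + 2 * χ T x ≤ sum (λ t → χ T t * mult t x)
      pointwise x with x ∈? T
      ... | yes x∈T = begin
        χ (ball T) x + 2                    ≤⟨ +-monoˡ-≤ 2 (𝟙≤ (x ∈? ball T) (λ _ → ≤-refl)) ⟩
        3                                   ≡⟨ trans (sym ∣leaves∣) (∣p∣≡sum-χ T) ⟩
        sum (χ T)                           ≤⟨ sum-mono-≤ counted ⟩
        sum (λ t → χ T t * mult t x)        ∎
        where
        counted : ∀ t → χ T t ≤ χ T t * mult t x
        counted t with t ∈? T
        ... | no  _   = z≤n
        ... | yes t∈T = ≤-trans
          (1≤mult (inj₂ (inj₂ (u , Adj-sym (adjacent t∈T) , adjacent x∈T))))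
          (≤-reflexive (sym (*-identityˡ (mult t x))))
      ... | no _ = ≤-trans (≤-reflexive (+-identityʳ (χ (ball T) x))) (𝟙≤ (x ∈? ball T) covered)
        where
        covered : x ∈ ball T → 1 ≤ sum (λ t → χ T t * mult t x)
        covered x∈ with t , t∈T , tx ← ∈ball⁻ x∈ = ≤-trans
          (subst (λ k → 1 ≤ k * mult t x) (sym (𝟙-true (t ∈? T) t∈T))
            (subst (1 ≤_) (sym (*-identityˡ (mult t x))) (1≤mult tx)))
          (term≤sum (λ t → χ T t * mult t x) t)

  -- Two vertices on 4-cycles at distance three

  diamond-ball : ∀ {u} → Diamond u → ∣ ball ⁅ u ⁆ ∣ ≤ suc K
  diamond-ball {u} d with x , 2≤x ← diamond⇒2≤mult d = +-cancelʳ-≤ 1 _ _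
    (≤-trans (+-monoʳ-≤ ∣ ball ⁅ u ⁆ ∣ (+-mono-≤ (k<mult⇒k≤excess (ball ⁅ u ⁆) 2≤x) z≤n))
      (≤-trans (excess≤2+K {xs = x ∷ []} ⊆-refl ([] ∷ [])) (≤-reflexive (+-comm 1 (suc K)))))

  -- The 4-cycle wastes a third path in addition to those ending at the covered vertices `w` and
  -- `y`.
  diamond-fresh : ∀ {S v w} → Diamond v → v ∉ ball S → w ∈ ball S → Adj v w →
                  suc ∣ ball ⁅ v ⁆ ∩ ∁ (ball S) ∣ ≤ K
  diamond-fresh {S} {v} {w} d v∉ w∈ vw
    with x , 2≤x ← diamond⇒2≤mult d with y , y∈ , wy ← boundary v∉ w∈ vw =
    +-cancelʳ-≤ 2 _ _ (≤-trans (≤-reflexive (sym (+-suc c 2))) (≤-trans enough (≤-reflexive (+-comm 2 K))))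
    where
    fresh = ball ⁅ v ⁆ ∩ ∁ (ball S)
    c = ∣ fresh ∣
    excess : Vertex → ℕ
    excess x = mult v x ∸ χ fresh x
    saved : ∀ {x k} → x ∈ ball S → k ≤ mult v x → k ≤ excess x
    saved = k≤mult⇒k≤excess-old
    vw₁ : 1 ≤ mult v w
    vw₁ = 1≤mult (inj₂ (inj₁ vw))
    vy₁ : 1 ≤ mult v y
    vy₁ = 1≤mult (inj₂ (inj₂ (w , vw , wy)))
    total : ∀ {xs k} → Unique xs → k ≤ List.sum (map excess xs) → c + k ≤ 2 + K
    total xs! k≤ = ≤-trans (+-monoʳ-≤ c k≤) (excess≤2+K (p∩q⊆p _ _) xs!)
    enough : c + 3 ≤ 2 + K
    enough with x ≟ w | x ≟ y
    -- If the vertex `x` opposite to `v` is itself `w` or `y`, it is covered and both of its paths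
    -- are wasted.
    ... | yes refl | _ = total ((Adj⇒≢ wy ∷ []) ∷ [] ∷ [])
      (+-mono-≤ (saved w∈ 2≤x) (+-mono-≤ (saved y∈ vy₁) z≤n))
    ... | no _ | yes refl = total ((Adj⇒≢ wy ∷ []) ∷ [] ∷ [])
      (+-mono-≤ (saved w∈ vw₁) (+-mono-≤ (saved y∈ 2≤x) z≤n))
    -- Otherwise `x` may be fresh, and only its second path is sure to be wasted.
    ... | no x≢w | no x≢y = total ((x≢w ∷ x≢y ∷ []) ∷ (Adj⇒≢ wy ∷ []) ∷ [] ∷ [])
      (+-mono-≤ (k<mult⇒k≤excess fresh 2≤x) (+-mono-≤ (saved w∈ vw₁) (+-mono-≤ (saved y∈ vy₁) z≤n)))

  -- The ball of `u` exceeds the allowance `K` by at most one, and `z` makes up for it by adding at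
  -- most `K - 1` vertices.
  diamond-pair : ∀ {u z w} → Diamond u → Diamond z → z ∉ ball ⁅ u ⁆ → w ∈ ball ⁅ u ⁆ → Adj z w →
                 ∣ ball (⁅ u ⁆ ∪ ⁅ z ⁆) ∣ ≤ ∣ ⁅ u ⁆ ∪ ⁅ z ⁆ ∣ * K
  diamond-pair {u} {z} du dz z∉ w∈ zw = begin
    ∣ ball (⁅ u ⁆ ∪ ⁅ z ⁆) ∣                      ≤⟨ ball-∪ ⁅ u ⁆ ⁅ z ⁆ ⟩
    ∣ ball ⁅ u ⁆ ∣ + c                            ≤⟨ +-monoˡ-≤ c (diamond-ball du) ⟩
    suc K + c                                     ≡⟨ +-suc K c ⟨
    K + suc c                                     ≤⟨ +-monoʳ-≤ K (diamond-fresh dz z∉ w∈ zw) ⟩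
    K + K                                         ≡⟨ cong (λ k → K + k) (+-identityʳ K) ⟨
    2 * K                                         ≡⟨ cong₂ (λ k l → (k + l) * K) (∣⁅x⁆∣≡1 u) (∣⁅x⁆∣≡1 z) ⟨
    (∣ ⁅ u ⁆ ∣ + ∣ ⁅ z ⁆ ∣) * K                   ≤⟨ *-monoˡ-≤ K (disjoint⇒∣p∣+∣q∣≤∣p∪q∣ ⁅ u ⁆ ⁅ z ⁆ disjoint) ⟩
    ∣ ⁅ u ⁆ ∪ ⁅ z ⁆ ∣ * K                         ∎
    where
    open ≤-Reasoning
    c = ∣ ball ⁅ z ⁆ ∩ ∁ (ball ⁅ u ⁆) ∣
    disjoint : ∀ {x} → x ∈ ⁅ u ⁆ → x ∉ ⁅ z ⁆
    disjoint x∈u x∈z = z∉ (∈ball⁺ x∈u (inj₁ (x∈⁅y⁆⇒x≡y z x∈z)))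

  -- The adjacency matrix restricted to `B` is symmetric with zero diagonal, so its total is even.
  -- As no edge leaves `B`, each row of a vertex in `B` still sums to the full degree `D`.
  handshake : ∀ {B} → (∀ {v w} → v ∈ B → Adj v w → w ∈ B) → (∀ {v} → v ∈ B → degree v ≡ D) →
              2 ∣ℕ ∣ B ∣ * D
  handshake {B} closed regular = subst (2 ∣ℕ_) total
    (symmetric-sum-even f f-sym (λ v → trans (cong (λ a → χ B v * (χ B v * a)) (A-irrefl v))
                                              (trans (cong (χ B v *_) (*-zeroʳ (χ B v))) (*-zeroʳ (χ B v)))))
    where
    f : Vertex → Vertex → ℕ
    f v w = χ B v * (χ B w * A v w)

    swap : ∀ a b c → a * (b * c) ≡ b * (a * c)
    swap = solve-∀

    f-sym : ∀ v w → f v w ≡ f w v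
    f-sym v w = trans (swap (χ B v) (χ B w) (A v w)) (cong (λ a → χ B w * (χ B v * a)) (A-sym v w))

    open ≡-Reasoning
    row : ∀ v → sum (f v) ≡ χ B v * D
    row v with v ∈? B
    ... | no  _   = sym (*-distribˡ-sum 0 (λ w → χ B w * A v w))
    ... | yes v∈B = begin
      sum (λ w → 1 * (χ B w * A v w))   ≡⟨ sum-cong-≗ inner ⟩
      sum (A v)                         ≡⟨ degree≡sum-A v ⟨
      degree v                          ≡⟨ regular v∈B ⟩
      D                                 ≡⟨ *-identityˡ D ⟨
      1 * D                             ∎
      where
      inner : ∀ w → 1 * (χ B w * A v w) ≡ A v w
      inner w with Adj? v w
      ... | no  _  = trans (*-identityˡ _) (*-zeroʳ (χ B w))
      ... | yes vw = cong (λ c → 1 * (c * 1)) (𝟙-true (w ∈? B) (closed v∈B vw))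

    total : sum (λ v → sum (f v)) ≡ ∣ B ∣ * D
    total = begin
      sum (λ v → sum (f v))   ≡⟨ sum-cong-≗ row ⟩
      sum (λ v → χ B v * D)   ≡⟨ *-distribʳ-sum D (χ B) ⟨
      sum (χ B) * D           ≡⟨ cong (_* D) (∣p∣≡sum-χ B) ⟨
      ∣ B ∣ * D               ∎

  -- Components not met by the ball of `S`, with every vertex tight

  module _ {S} (closed : ∀ {v w} → v ∉ ball S → Adj v w → w ∉ ball S)
               (tight : ∀ {v} → v ∉ ball S → Tight v) where

    ball-stays : ∀ {u x} → u ∉ ball S → x ∈ ball ⁅ u ⁆ → x ∉ ball S
    ball-stays u∉ x∈ with ∈ball-⁅⁆⁻ x∈
    ... | inj₁ refl                  = u∉
    ... | inj₂ (inj₁ ux)             = closed u∉ ux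
    ... | inj₂ (inj₂ (w , uw , wx))  = closed (closed u∉ uw) wx

    star-extension : ∀ {u} → u ∉ ball S → Star u → Extension S
    star-extension {u} u∉ star =
      T , nonempty , star-oddIndependent (tight u∉) star , (λ t∈ → closed u∉ (adjacent t∈)) ,
      ≤-trans (∣p∩q∣≤∣p∣ (ball T) _)
        (subst (λ k → ∣ ball T ∣ ≤ k * K) (sym ∣leaves∣) (star-ball (tight u∉) star))
      where
      open Star star renaming (leaves to T)
      nonempty : Nonempty T
      nonempty = decidable-stable (nonempty? T) λ empty →
        case trans (sym ∣leaves∣) (trans (cong ∣_∣ (Empty-unique empty)) (∣⊥∣≡0 order)) of λ ()

    -- Without a star at `u`, the degree is 3 and `u` is on a 4-cycle. A vertex `z` at distance
    -- three then has a star of its own or pairs up with `u`. If there is no such `z`, the ball of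
    -- `u` is a whole component, which parity excludes.
    tight-extension : ∀ {u} → u ∉ ball S → Extension S
    tight-extension {u} u∉ with tight⇒star (tight u∉)
    ... | inj₁ star = star-extension u∉ star
    ... | inj₂ (D≡3 , du)
      with any? (λ z → any? λ w → ¬? (z ∈? ball ⁅ u ⁆) ×-dec (w ∈? ball ⁅ u ⁆) ×-dec Adj? z w)
    ...   | yes (z , w , z∉ , w∈ , zw) = pair
      where
      z∉S : z ∉ ball S
      z∉S = closed (ball-stays u∉ w∈) (Adj-sym zw)

      pair : Extension S
      pair with tight⇒star (tight z∉S)
      ... | inj₁ star     = star-extension z∉S star
      ... | inj₂ (_ , dz) =
        ⁅ u ⁆ ∪ ⁅ z ⁆ , (u , p⊆p∪q ⁅ z ⁆ (x∈⁅x⁆ u)) ,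
        ∪-oddIndependent (⁅⁆-oddIndependent u) (⁅⁆-oddIndependent z)
          (λ t∈ → subst (_∉ ball ⁅ u ⁆) (sym (x∈⁅y⁆⇒x≡y z t∈)) z∉) ,
        outside-ball ,
        ≤-trans (∣p∩q∣≤∣p∣ (ball (⁅ u ⁆ ∪ ⁅ z ⁆)) _) (diamond-pair du dz z∉ w∈ zw)
        where
        outside-ball : ∀ {t} → t ∈ ⁅ u ⁆ ∪ ⁅ z ⁆ → t ∉ ball S
        outside-ball t∈ with x∈p∪q⁻ ⁅ u ⁆ ⁅ z ⁆ t∈
        ... | inj₁ t∈u = subst (_∉ ball S) (sym (x∈⁅y⁆⇒x≡y u t∈u)) u∉
        ... | inj₂ t∈z = subst (_∉ ball S) (sym (x∈⁅y⁆⇒x≡y z t∈z)) z∉S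
    -- The ball of u is then a cubic graph on nine vertices.
    ...   | no none = contradiction even (from-no (2 ∣? 27))
      where
      ∣ball∣ : ∣ ball ⁅ u ⁆ ∣ ≡ D * D
      -- The 4-cycle at `u` bounds the ball from above by `K + 1`, tightness from below.
      ∣ball∣ = trans (≤-antisym (diamond-ball du) (tight u∉)) (sym D²≡1+K)

      even : 2 ∣ℕ 27
      even = subst (λ d → 2 ∣ℕ d * d * d) D≡3 (subst (λ k → 2 ∣ℕ k * D) ∣ball∣ (handshake
        (λ {v} {w} v∈ vw → decidable-stable (w ∈? ball ⁅ u ⁆) λ w∉ → none (w , v , w∉ , v∈ , Adj-sym vw))
        (λ v∈ → tight-degree (tight (ball-stays u∉ v∈)))))

  -- Each case assumes that the previous ones fail. An uncovered vertex next to the ball is always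
  -- affordable. If there is none, the uncovered vertices form whole components, and one with a ball
  -- of at most `K` elements can be taken alone. Otherwise all of them are tight.
  extension : ∀ {S v} → v ∉ ball S → Extension S
  extension {S} {v} v∉
    with any? (λ v → any? λ w → ¬? (v ∈? ball S) ×-dec (w ∈? ball S) ×-dec Adj? v w)
  ... | yes (v , w , v∉ , w∈ , vw) = boundary-extension v∉ w∈ vw
  ... | no separated with any? (λ u → ¬? (u ∈? ball S) ×-dec (∣ ball ⁅ u ⁆ ∣ ≤? K))
  ...   | yes (u , u∉ , small) = ⁅⁆-extension u∉ (≤-trans (∣p∩q∣≤∣p∣ (ball ⁅ u ⁆) _) small)
  ...   | no noSmall = tight-extension
    (λ v∉ vw w∈ → separated (_ , _ , v∉ , w∈ , vw))
    (λ v∉ → ≰⇒> λ small → noSmall (_ , v∉ , small)) v∉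

  -- Each extension adds a vertex, so order steps suffice.
  saturate : ∀ fuel S → order ≤ fuel + ∣ S ∣ → OddIndependent S → ∣ ball S ∣ ≤ ∣ S ∣ * K →
             ∃ λ S′ → OddIndependent S′ × order ≤ ∣ S′ ∣ * K
  saturate fuel S order≤ S-odd few with any? (λ v → ¬? (v ∈? ball S))
  ... | no full = S , S-odd , ≤-trans (≤-reflexive (sym (∣⊤∣≡n order)))
    (≤-trans (p⊆q⇒∣p∣≤∣q∣ {p = ⊤} {q = ball S} λ {x} _ → decidable-stable (x ∈? ball S) λ x∉ → full (x , x∉)) few)
  ... | yes (v , v∉) with T , (t , t∈) , T-odd , far , fewT ← extension v∉ = continue fuel order≤
    where
    open ≤-Reasoning
    larger : ∣ S ∣ + ∣ T ∣ ≤ ∣ S ∪ T ∣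
    larger = disjoint⇒∣p∣+∣q∣≤∣p∪q∣ S T λ x∈S x∈T → far x∈T (∈ball⁺ x∈S (inj₁ refl))

    strictly : suc ∣ S ∣ ≤ ∣ S ∪ T ∣
    strictly = begin
      suc ∣ S ∣         ≡⟨ +-comm 1 ∣ S ∣ ⟩
      ∣ S ∣ + 1         ≤⟨ +-monoʳ-≤ ∣ S ∣ (≤-trans (s≤s z≤n) (x∈p⇒∣p-x∣<∣p∣ t∈)) ⟩
      ∣ S ∣ + ∣ T ∣     ≤⟨ larger ⟩
      ∣ S ∪ T ∣         ∎

    -- The fuel is inspected only after an extension has been found: without fuel `S` already has
    -- `order` elements, yet `S ∪ T` is strictly larger.
    continue : ∀ fuel → order ≤ fuel + ∣ S ∣ → ∃ λ S′ → OddIndependent S′ × order ≤ ∣ S′ ∣ * K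
    continue zero       order≤ = contradiction (≤-trans strictly (∣p∣≤n (S ∪ T))) (≤⇒≯ order≤)
    continue (suc fuel) order≤ = saturate fuel (S ∪ T)
      (≤-trans order≤ (≤-trans (≤-reflexive (sym (+-suc fuel ∣ S ∣))) (+-monoʳ-≤ fuel strictly)))
      (∪-oddIndependent S-odd T-odd far)
      (begin
        ∣ ball (S ∪ T) ∣                              ≤⟨ ball-∪ S T ⟩
        ∣ ball S ∣ + ∣ ball T ∩ ∁ (ball S) ∣          ≤⟨ +-mono-≤ few fewT ⟩
        ∣ S ∣ * K + ∣ T ∣ * K                         ≡⟨ *-distribʳ-+ K ∣ S ∣ ∣ T ∣ ⟨
        (∣ S ∣ + ∣ T ∣) * K                           ≤⟨ *-monoˡ-≤ K larger ⟩
        ∣ S ∪ T ∣ * K                                 ∎)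

  largeOddIndependent : ∃ λ S → OddIndependent S × order ≤ ∣ S ∣ * K
  largeOddIndependent = saturate order ⊥ (m≤m+n order _) ⊥-oddIndependent
    (≤-trans (≤-reflexive (trans (cong ∣_∣ (Empty-unique λ (x , x∈) → ∉⊥ (proj₁ (proj₂ (∈ball⁻ x∈))))) (∣⊥∣≡0 order))) z≤n)

-- Opened only here: in scope with _+_, it makes ∣ p ∣ + ∣ q ∣ ambiguous.
open import Data.Integer.Base using (+_)

-- Division in `ℚ` reduces to lowest terms, so the comparison is moved to unnormalised rationals,
-- where it is cross multiplication.
m≤n*d⇒m/d≤n/1 : ∀ m n d .{{_ : NonZero d}} → m ≤ n * d → + n / 1 ≥ + m / d
m≤n*d⇒m/d≤n/1 m n (suc d) m≤n*d = ℚ.toℚᵘ-cancel-≤ (begin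
  _                      ≃⟨ ℚ.toℚᵘ-fromℚᵘ (ℚᵘ.mkℚᵘ (+ m) d) ⟩
  -- The second argument of `mkℚᵘ` is the denominator minus one.
  ℚᵘ.mkℚᵘ (+ m) d        ≤⟨ ℚᵘ.*≤* cross ⟩
  ℚᵘ.mkℚᵘ (+ n) 0        ≃⟨ ℚ.toℚᵘ-fromℚᵘ (ℚᵘ.mkℚᵘ (+ n) 0) ⟨
  _                      ∎)
  where
  open ℚᵘ.≤-Reasoning
  cross : + m ℤ.* + 1 ℤ.≤ + n ℤ.* + suc d
  cross = subst₂ ℤ._≤_ (sym (ℤ.*-identityʳ (+ m))) (ℤ.pos-* n (suc d)) (ℤ.+≤+ m≤n*d)

theorem5 : (G : Graph) → let open Graph G in (3≤Δ : 3 ≤ Δ) →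
    + αod G / 1 ≥ _/_ (+ order) (Δ ^ 2 ∸ 1) {{m²∸1-nonZero 3≤Δ}}
theorem5 G 3≤Δ =
  let S , S-odd , order≤ = Greedy.largeOddIndependent G (degree≤Δ G) 3≤Δ Δ²≡1+K in
  m≤n*d⇒m/d≤n/1 order (αod G) (Δ ^ 2 ∸ 1) {{m²∸1-nonZero 3≤Δ}}
    (≤-trans order≤ (*-monoˡ-≤ (Δ ^ 2 ∸ 1) (oddIndependent⇒∣S∣≤αod G S-odd)))
  where
  open Graph G
  Δ²≡1+K : Δ * Δ ≡ suc (Δ ^ 2 ∸ 1)
  -- `Δ ^ 2` unfolds to `Δ * (Δ * 1)`, and it is at least 1, so the subtraction is not truncated.
  Δ²≡1+K = trans (cong (Δ *_) (sym (*-identityʳ Δ)))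
    (sym (m+[n∸m]≡n (≤-trans (s≤s z≤n) (^-monoˡ-≤ 2 3≤Δ))))
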